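{- The IB unboundedness problem is decidable for FIFO machines: given a FIFO machine $M=(Q,\mathit{Ch},\Sigma,\Delta,q_0)$ and a tuple $(L_c)_{c\in\mathit{Ch}}$ of non-empty regular bounded languages $L_c\subseteq\Sigma_c^\ast$, it is decidable whether $\mathrm{Reach}_M(\mathrm{Pref}(L_!))$ is infinite.
   Context: A bounded language over non-empty words $(w_1,\ldots,w_n)$ is a language $L\subseteq w_1^\ast\cdots w_n^\ast$. A FIFO machine is $M=(Q,\mathit{Ch},\Sigma,\Delta,q_0)$ with finite control states $Q$, initial state $q_0$, finite channels $\mathit{Ch}$, alphabet $\Sigma=\biguplus_c\Sigma_c$, and $\Delta\subseteq Q\times A_M\times Q$, $A_M=\{c!a,c?a\mid c\in\mathit{Ch},a\in\Sigma_c\}$. Configurations $(q,\mathbf{w})$ with $\mathbf{w}\in\prod_c\Sigma_c^\ast$; initial $(q_0,(\varepsilon)_c)$. A send $c!a$ appends $a$ to channel $c$; a receive $c?a$ removes $a$ from the head of channel $c$ (only possible if $a$ is at the head); other channels unchanged; the control state moves along a transition of $\Delta$. $\mathrm{Reach}_M(L)$ is the set of configurations reachable from the initial one via a label word in $L\subseteq A_M^\ast$. $L_!=\{\sigma\in A_M^\ast\mid\mathrm{proj}_{c!}(\sigma)\in L_c\ \forall c\}$, where $\mathrm{proj}_{c!}$ keeps the messages of send actions on $c$ and erases all other actions. $\mathrm{Pref}(L)$ is the set of prefixes of words in $L$. -}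

module Defs where

open import Data.Fin.Base using (Fin)
open import Data.Fin.Properties using (_≟_)
import Data.Fin.Subset as Subset
open Subset using (Subset)
open import Data.List.Base using (List; []; _∷_; _∷ʳ_; _++_; concat; replicate; foldl; mapMaybe)
open import Data.List.Membership.Propositional using (_∈_)
open import Data.List.Relation.Unary.All using (All)
open import Data.List.Relation.Unary.Any using (Any)
open import Data.Maybe.Base using (Maybe; just; nothing)
open import Data.Nat.Base using (ℕ)
open import Data.Product.Base using (_×_; _,_; ∃-syntax)
open import Level using (0ℓ)
open import Relation.Binary.PropositionalEquality using (_≡_; _≢_; refl)
open import Relation.Nullary using (¬_; yes; no)
open import Relation.Unary using (Pred; _⊆_; _≐_)

Language : Set → Set₁
Language A = Pred (List A) 0ℓ

Pref : {A : Set} → Language A → Language A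
Pref L u = ∃[ v ] L (u ++ v)

-- StarProduct (w₁ ∷ … ∷ wₙ ∷ []) is w₁* ⋯ wₙ*.
data StarProduct {A : Set} : List (List A) → Language A where
  []  : StarProduct [] []
  _∷_ : ∀ {w ws v} (k : ℕ) → StarProduct ws v →
        StarProduct (w ∷ ws) (concat (replicate k w) ++ v)

-- The case n = 0 only adds sublanguages of {ε}; it is needed when the
-- alphabet is empty, as there are then no non-empty words.
Bounded : {A : Set} → Language A → Set
Bounded L = ∃[ ws ] All (_≢ []) ws × L ⊆ StarProduct ws

record DFA (A : Set) : Set where
  field
    #states : ℕ
    start   : Fin #states
    δ       : Fin #states → A → Fin #states
    final   : Subset #states

Accepted : {A : Set} → DFA A → Language A
Accepted D w = foldl δ start w Subset.∈ final
  where open DFA D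

Regular : {A : Set} → Language A → Set
Regular {A} L = ∃[ D ] L ≐ Accepted {A} D

data Action {Ch : Set} (Msg : Ch → Set) : Set where
  _!_ : (c : Ch) → Msg c → Action Msg
  _¿_ : (c : Ch) → Msg c → Action Msg

-- The finite sets Q, Ch and Σ_c are taken to be initial segments of ℕ.  The
-- alphabets are disjoint because letters are indexed by their channel.
record FIFOMachine : Set where
  field
    #Q  : ℕ
    #Ch : ℕ
    #Σ  : Fin #Ch → ℕ

  Q : Set
  Q = Fin #Q

  Ch : Set
  Ch = Fin #Ch

  Msg : Ch → Set
  Msg c = Fin (#Σ c)

  Act : Set
  Act = Action Msg

  field
    Δ  : List (Q × Act × Q)
    q₀ : Q

  Contents : Set
  Contents = (c : Ch) → List (Msg c)

  Config : Set
  Config = Q × Contents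

  -- Pointwise equality of channel contents, since functions are not
  -- extensional.
  _≈_ : Config → Config → Set
  (q , w) ≈ (q′ , w′) = q ≡ q′ × (∀ c → w c ≡ w′ c)

  initial : Config
  initial = q₀ , λ _ → []

  data Step : Config → Act → Config → Set where
    send : ∀ {q q′ w w′ c a} →
           (q , c ! a , q′) ∈ Δ →
           w′ c ≡ w c ∷ʳ a →
           (∀ d → d ≢ c → w′ d ≡ w d) →
           Step (q , w) (c ! a) (q′ , w′)
    receive : ∀ {q q′ w w′ c a} →
           (q , c ¿ a , q′) ∈ Δ →
           w c ≡ a ∷ w′ c →
           (∀ d → d ≢ c → w′ d ≡ w d) →
           Step (q , w) (c ¿ a) (q′ , w′)

  data Run : Config → List Act → Config → Set where
    []  : ∀ {γ} → Run γ [] γ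
    _∷_ : ∀ {γ γ′ γ″ α σ} → Step γ α γ′ → Run γ′ σ γ″ → Run γ (α ∷ σ) γ″

  Reach : Language Act → Pred Config 0ℓ
  Reach L γ = ∃[ σ ] L σ × Run initial σ γ

  sentOn : (c : Ch) → Act → Maybe (Msg c)
  sentOn c (d ! a) with d ≟ c
  ... | yes refl = just a
  ... | no  _    = nothing
  sentOn c (d ¿ a) = nothing

  proj! : (c : Ch) → List Act → List (Msg c)
  proj! c = mapMaybe (sentOn c)

  _₍!₎ : ((c : Ch) → Language (Msg c)) → Language Act
  (L ₍!₎) σ = ∀ c → L c (proj! c σ)

  Finite : Pred Config 0ℓ → Set
  Finite P = ∃[ γs ] (∀ γ → P γ → Any (γ ≈_) γs)

  Infinite : Pred Config 0ℓ → Set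
  Infinite P = ¬ Finite P

-- Since only prefixes of words are executed, a word is admissible as soon as its
-- projection to every channel is a prefix of a word of L_c.  Each letter sent is
-- annotated with a position in w₁* ⋯ wₙ*, and a channel state consists of the
-- position expected next, the state of the automaton of L_c, and the annotated
-- queue.  Configurations are quasi-ordered by equality of the finite data
-- (including the position at the head of each queue) and ≤ on two counts per
-- channel.  This order is almost full, in the inductive and constructive sense of
-- Coquand, so a search of the annotated system that is cut at the first ordered
-- pair on each branch terminates.  If a run leads from a configuration to a larger
-- one, then on every channel it either receives nothing, or turns a queue lying in
-- some w_i* into one that lies in w_i* at the same phase and is no shorter.  In
-- both cases the run can be repeated forever.  Hence a strictly longer queue
-- yields infinitely many configurations, and if none occurs, then the finitely
-- many configurations met by the search are closed under steps.  No zero test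
-- needs to be decided on an unbounded channel, so reachability in vector addition
-- systems is not involved.
module Submission where

open import Defs
open import Data.Empty using (⊥; ⊥-elim)
open import Data.Fin.Base using (Fin; zero; suc; toℕ)
import Data.Fin.Properties as Fin
import Data.Fin.Subset as Subset
import Data.Fin.Subset.Properties as Subset
open import Data.List.Base
  using ( List; []; _∷_; _∷ʳ_; _++_; allFin; cartesianProductWith; concat; concatMap; filter; foldl
        ; head; length; lookup; map; mapMaybe; replicate; tabulate )
open import Data.List.Properties
open import Data.List.Membership.Propositional using (_∈_; find; lose)
open import Data.List.Membership.Propositional.Properties
open import Data.List.Relation.Unary.All as All using (All; []; _∷_)
open import Data.List.Relation.Unary.Any as Any using (Any; here; there)
import Data.List.Relation.Unary.All.Properties as All
import Data.List.Relation.Unary.Any.Properties as Any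
open import Data.List.Relation.Unary.Unique.Propositional using (Unique; []; _∷_)
open import Data.List.Relation.Unary.Unique.Propositional.Properties using (allFin⁺)
open import Data.Maybe.Base as Maybe using (Maybe; just; nothing)
import Data.Maybe.Properties as Maybe
open import Data.Nat.Base using (ℕ; zero; suc; _+_; _≤_; _<_; z≤n; s≤s; _∸_)
open import Data.Nat.ListAction using (sum)
import Data.Nat.Properties as ℕ
open import Data.Nat.Tactic.RingSolver using (solve-∀)
open import Data.Product.Base using (_×_; _,_; proj₁; proj₂; ∃-syntax)
open import Data.Sum.Base as Sum using (_⊎_; inj₁; inj₂; [_,_]′)
open import Function.Base using (_∘_; id; _on_)
open import Relation.Binary.Core using (Rel)
open import Relation.Binary.Construct.Closure.ReflexiveTransitive using (Star; ε; _◅_; _◅◅_)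
open import Relation.Binary.Definitions using (Decidable; DecidableEquality; Reflexive)
open import Relation.Binary.PropositionalEquality
import Relation.Nullary.Decidable as Dec
open import Relation.Nullary using (Dec; yes; no; ¬_; contradiction)
open import Relation.Nullary.Decidable using (_×-dec_; _⊎-dec_)
open import Relation.Unary using (Satisfiable)
open import Level using (0ℓ)

-- Almost-full relations

-- Constructive form of: every infinite sequence contains an ordered pair, the smaller element
-- first. Once `x` is drawn, a later `y` with `R x y` makes the sequence good, whatever follows.
data AF {A : Set} (R : Rel A 0ℓ) : Set where
  now   : (∀ x y → R x y) → AF R
  later : (∀ x → AF (λ y z → R y z ⊎ R x y)) → AF R

module _ {A : Set} where

  AF-mono : {R S : Rel A 0ℓ} → (∀ {x y} → R x y → S x y) → AF R → AF S
  AF-mono f (now r)   = now λ x y → f (r x y)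
  AF-mono f (later r) = later λ x → AF-mono (Sum.map f f) (r x)

  -- The intersection theorem is obtained in three stages, in which the parts P and Q to
  -- be intersected depend on none, one or both of the arguments.

  AF-∩₀ : {R S C : Rel A 0ℓ} {P Q : Set} → AF R → AF S →
          (∀ {y z} → R y z → C y z ⊎ P) →
          (∀ {y z} → S y z → C y z ⊎ Q) →
          AF (λ y z → C y z ⊎ P × Q)
  AF-∩₀ (now r) s f g =
    AF-mono (λ {y} {z} t → [ inj₁ , (λ p → Sum.map id (p ,_) (g t)) ]′ (f (r y z))) s
  AF-∩₀ (later r) s f g = later λ x → AF-mono
    [ Sum.map inj₁ inj₁ , inj₁ ∘ inj₂ ]′
    (AF-∩₀ {C = λ y z → _ ⊎ _} (r x) s
      [ [ inj₁ ∘ inj₁ , inj₂ ]′ ∘ f , [ inj₁ ∘ inj₂ , inj₂ ]′ ∘ f ]′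
      ([ inj₁ ∘ inj₁ , inj₂ ]′ ∘ g))

  AF-∩₁ : {R S C : Rel A 0ℓ} {P Q : A → Set} → AF R → AF S →
          (∀ {y z} → R y z → C y z ⊎ P y) →
          (∀ {y z} → S y z → C y z ⊎ Q y) →
          AF (λ y z → C y z ⊎ P y × Q y)
  AF-∩₁ (now r) s f g =
    AF-mono (λ {y} {z} t → [ inj₁ , (λ p → Sum.map id (p ,_) (g t)) ]′ (f (r y z))) s
  AF-∩₁ (later r) (now s) f g =
    AF-mono (λ {y} {z} t → [ inj₁ , (λ q → Sum.map id (_, q) (f t)) ]′ (g (s y z))) (later r)
  AF-∩₁ {C = C} {P} {Q} (later r) (later s) f g = later λ x → AF-mono
    [ [ [ inj₁ ∘ inj₁ , inj₂ ∘ inj₁ ]′ , inj₁ ∘ inj₂ ]′ , inj₂ ∘ inj₂ ]′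
    -- After `x` is drawn, each recursive call descends in one premise and absorbs `P x` or `Q x`
    -- into its `C`. These leftovers have one argument fewer than `P y` and `Q y`, so the previous
    -- stage intersects them.
    (AF-∩₀ {C = λ y z → (C y z ⊎ C x y) ⊎ P y × Q y}
      (AF-∩₁ {C = λ y z → (C y z ⊎ C x y) ⊎ P x} {P} {Q} (r x) (later s)
        [ Sum.map (inj₁ ∘ inj₁) id ∘ f , inj₁ ∘ Sum.map inj₂ id ∘ f ]′
        (Sum.map (inj₁ ∘ inj₁) id ∘ g))
      (AF-∩₁ {C = λ y z → (C y z ⊎ C x y) ⊎ Q x} {P} {Q} (later r) (s x)
        (Sum.map (inj₁ ∘ inj₁) id ∘ f)
        [ Sum.map (inj₁ ∘ inj₁) id ∘ g , inj₁ ∘ Sum.map inj₂ id ∘ g ]′)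
      [ Sum.map inj₁ id , inj₁ ∘ inj₂ ]′
      [ Sum.map inj₁ id , inj₁ ∘ inj₂ ]′)

  AF-∩₂ : {R S C P Q : Rel A 0ℓ} → AF R → AF S →
          (∀ {y z} → R y z → C y z ⊎ P y z) →
          (∀ {y z} → S y z → C y z ⊎ Q y z) →
          AF (λ y z → C y z ⊎ P y z × Q y z)
  AF-∩₂ (now r) s f g =
    AF-mono (λ {y} {z} t → [ inj₁ , (λ p → Sum.map id (p ,_) (g t)) ]′ (f (r y z))) s
  AF-∩₂ (later r) (now s) f g =
    AF-mono (λ {y} {z} t → [ inj₁ , (λ q → Sum.map id (_, q) (f t)) ]′ (g (s y z))) (later r)
  AF-∩₂ {C = C} {P} {Q} (later r) (later s) f g = later λ x → AF-mono
    [ [ [ inj₁ ∘ inj₁ , inj₂ ∘ inj₁ ]′ , inj₁ ∘ inj₂ ]′ , inj₂ ∘ inj₂ ]′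
    (AF-∩₁ {C = λ y z → (C y z ⊎ C x y) ⊎ P y z × Q y z}
      (AF-∩₂ {C = λ y z → (C y z ⊎ C x y) ⊎ P x y} {P} {Q} (r x) (later s)
        [ Sum.map (inj₁ ∘ inj₁) id ∘ f , inj₁ ∘ Sum.map inj₂ id ∘ f ]′
        (Sum.map (inj₁ ∘ inj₁) id ∘ g))
      (AF-∩₂ {C = λ y z → (C y z ⊎ C x y) ⊎ Q x y} {P} {Q} (later r) (s x)
        (Sum.map (inj₁ ∘ inj₁) id ∘ f)
        [ Sum.map (inj₁ ∘ inj₁) id ∘ g , inj₁ ∘ Sum.map inj₂ id ∘ g ]′)
      [ Sum.map inj₁ id , inj₁ ∘ inj₂ ]′
      [ Sum.map inj₁ id , inj₁ ∘ inj₂ ]′)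

  infixr 4 _AF-∩_
  _AF-∩_ : {R S : Rel A 0ℓ} → AF R → AF S → AF (λ x y → R x y × S x y)
  r AF-∩ s = AF-mono [ ⊥-elim , id ]′ (AF-∩₂ {C = λ _ _ → ⊥} r s inj₂ inj₂)

  AF-Π : ∀ n {R : Fin n → Rel A 0ℓ} → (∀ i → AF (R i)) → AF (λ x y → ∀ i → R i x y)
  AF-Π zero    r = now λ _ _ ()
  AF-Π (suc n) r = AF-mono (λ { (p , ps) zero → p ; (p , ps) (suc i) → ps i })
                           (r zero AF-∩ AF-Π n (r ∘ suc))

AF-on : {A B : Set} {R : Rel B 0ℓ} (f : A → B) → AF R → AF (R on f)
AF-on f (now r)   = now λ x y → r (f x) (f y)
AF-on f (later r) = later λ x → AF-on f (r (f x))

AF-≤ : AF _≤_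
AF-≤ = later λ x → AF-mono id (below x)
  where
  -- Elements that reach the bound `n` count as good. A drawn `x` of at most `n` lowers the bound
  -- from `suc n` to `n`, since `n ≤ y` then gives `x ≤ y`; any other `x` is itself at the bound.
  below : ∀ n → AF (λ y z → y ≤ z ⊎ n ≤ y)
  below zero    = now λ _ _ → inj₂ z≤n
  below (suc n) = later λ x → case x
    where
    case : ∀ x → AF (λ y z → (y ≤ z ⊎ suc n ≤ y) ⊎ (x ≤ y ⊎ suc n ≤ x))
    case x with x ℕ.≤? n
    ... | yes x≤n = AF-mono [ inj₁ ∘ inj₁ , inj₂ ∘ inj₁ ∘ ℕ.≤-trans x≤n ]′ (below n)
    ... | no  x≰n = now λ _ _ → inj₂ (inj₂ (ℕ.≰⇒> x≰n))

-- Equality on Fin n is the intersection of ≤ and ≥, and ≥ is ≤ reflected.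
AF-Fin : ∀ {n} → AF {Fin n} _≡_
AF-Fin {n} = AF-mono antisym (AF-on toℕ AF-≤ AF-∩ AF-on (λ i → n ∸ toℕ i) AF-≤)
  where
  antisym : ∀ {i j : Fin n} → toℕ i ≤ toℕ j × n ∸ toℕ i ≤ n ∸ toℕ j → i ≡ j
  antisym {i} {j} (i≤j , j≤i) = Fin.toℕ-injective (ℕ.≤-antisym i≤j
    (ℕ.≮⇒≥ λ i<j → ℕ.≤⇒≯ j≤i (ℕ.∸-monoʳ-< i<j (ℕ.<⇒≤ (Fin.toℕ<n j)))))

index-injective : {A : Set} {xs : List A} (∈xs : ∀ x → x ∈ xs) {x y : A} →
                  Any.index (∈xs x) ≡ Any.index (∈xs y) → x ≡ y
index-injective {xs = xs} ∈xs {x} {y} eq =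
  trans (Any.lookup-index (∈xs x)) (trans (cong (lookup xs) eq) (sym (Any.lookup-index (∈xs y))))

AF-enumerated : {A : Set} {xs : List A} → (∀ x → x ∈ xs) → AF {A} _≡_
AF-enumerated ∈xs = AF-mono (index-injective ∈xs) (AF-on (Any.index ∘ ∈xs) AF-Fin)

-- Exploration of a finitely branching transition system

module Exploration
  {S : Set} (succs : S → List S) {_~_ R : Rel S 0ℓ} (R? : Decidable R) (~-refl : Reflexive _~_)
  (Pump : Set) (s₀ : S)
  (pump : ∀ {s t} → Star (λ x y → y ∈ succs x) s₀ s → Star (λ x y → y ∈ succs x) s t →
          R s t → t ~ s ⊎ Pump)
  where

  _⟶*_ : Rel S 0ℓ
  _⟶*_ = Star (λ x y → y ∈ succs x)

  data Bar (h : List S) : Set where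
    bar : (∀ t → ¬ Any (λ s → R s t) h → Bar (t ∷ h)) → Bar h

  -- A disjunct acquired through `later` says that `y` lies above an element of the branch `h`, and
  -- a branch is never extended by such a `y`.
  AF⇒Bar : ∀ {R′ h} → AF R′ → (∀ {y z} → R′ y z → R y z ⊎ Any (λ s → R s y) h) → Bar h
  AF⇒Bar (now r) f = bar λ t ¬h → bar λ z ¬th →
    ⊥-elim ([ ¬th ∘ here , ¬h ]′ (f (r t z)))
  AF⇒Bar (later r) f = bar λ t ¬h → AF⇒Bar (r t)
    [ Sum.map id there ∘ f , inj₂ ∘ [ here , ⊥-elim ∘ ¬h ]′ ∘ f ]′

  -- Transitions may also lead back to `h`, the ancestors still being expanded. Each ancestor turns
  -- these into internal transitions when it joins the explored set.
  Closed : List S → List S → Set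
  Closed I h = ∀ {x y} → x ∈ I → y ∈ succs x → Any (y ~_) I ⊎ Any (y ~_) h

  Exploration : S → List S → Set
  Exploration x h = ∃[ I ] x ∈ I × All (s₀ ⟶*_) I × Closed I h

  record Explorations (ts h : List S) : Set where
    field
      states  : List S
      reached : All (s₀ ⟶*_) states
      covered : All (λ t → Any (t ~_) states ⊎ Any (t ~_) h) ts
      closed  : Closed states h

  explore : ∀ x h → s₀ ⟶* x → All (λ s → s₀ ⟶* s × s ⟶* x) h → Bar (x ∷ h) →
            Pump ⊎ Exploration x h
  exploreAll : ∀ x h → s₀ ⟶* x → All (λ s → s₀ ⟶* s × s ⟶* x) h →
               (∀ t → ¬ Any (λ s → R s t) (x ∷ h) → Bar (t ∷ x ∷ h)) →
               ∀ ts → All (_∈ succs x) ts → Pump ⊎ Explorations ts (x ∷ h)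

  explore x h x* h* (bar f) = Sum.map₂ assemble (exploreAll x h x* h* f (succs x) (All.tabulate id))
    where
    assemble : Explorations (succs x) (x ∷ h) → Exploration x h
    assemble E = x ∷ states , here refl , x* ∷ reached , closed′
      where
      open Explorations E
      shift : ∀ {y} → Any (y ~_) states ⊎ Any (y ~_) (x ∷ h) → Any (y ~_) (x ∷ states) ⊎ Any (y ~_) h
      shift (inj₁ p)         = inj₁ (there p)
      shift (inj₂ (here p))  = inj₁ (here p)
      shift (inj₂ (there p)) = inj₂ p
      closed′ : Closed (x ∷ states) h
      closed′ (here refl) y∈ = shift (All.lookup covered y∈)
      closed′ (there z∈)  y∈ = shift (closed z∈ y∈)

  exploreAll x h x* h* f [] [] =
    inj₂ record { states = [] ; reached = [] ; covered = [] ; closed = λ () }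
  exploreAll x h x* h* f (t ∷ ts) (t∈ ∷ ts∈) with exploreAll x h x* h* f ts ts∈
  ... | inj₁ p = inj₁ p
  ... | inj₂ E with Any.any? (λ s → R? s t) (x ∷ h)
  -- The branch is cut: `t` either agrees with an ancestor, which then covers it, or gives `Pump`.
  ...   | yes Rst = Sum.map₂ include (pumpOrMeet ((x* , ε) ∷ h*) Rst)
    where
    open Explorations E
    pumpOrMeet : ∀ {l} → All (λ s → s₀ ⟶* s × s ⟶* x) l → Any (λ s → R s t) l → Pump ⊎ Any (t ~_) l
    pumpOrMeet ((s* , s*x) ∷ _) (here Rst) =
      [ inj₂ ∘ here , inj₁ ]′ (pump s* (s*x ◅◅ t∈ ◅ ε) Rst)
    pumpOrMeet (_ ∷ l*) (there Rst) = Sum.map₂ there (pumpOrMeet l* Rst)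
    include : Any (t ~_) (x ∷ h) → Explorations (t ∷ ts) (x ∷ h)
    include t~ = record
      { states = states ; reached = reached ; covered = inj₂ t~ ∷ covered ; closed = closed }
  ...   | no ¬Rst = Sum.map₂ merge
      (explore t (x ∷ h) (x* ◅◅ t∈ ◅ ε)
        ((x* , t∈ ◅ ε) ∷ All.map (λ (s* , s*x) → s* , s*x ◅◅ t∈ ◅ ε) h*) (f t ¬Rst))
    where
    open Explorations E
    merge : Exploration t (x ∷ h) → Explorations (t ∷ ts) (x ∷ h)
    merge (I , t∈I , I* , I-closed) = record
      { states  = I ++ states
      ; reached = All.++⁺ I* reached
      ; covered = inj₁ (Any.++⁺ˡ (Any.map (λ { refl → ~-refl }) t∈I)) ∷
                  All.map (Sum.map₁ (Any.++⁺ʳ I)) covered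
      ; closed  = closed′
      }
      where
      closed′ : Closed (I ++ states) (x ∷ h)
      closed′ z∈ y∈ with Any.++⁻ I z∈
      ... | inj₁ z∈I = Sum.map₁ Any.++⁺ˡ (I-closed z∈I y∈)
      ... | inj₂ z∈states = Sum.map₁ (Any.++⁺ʳ I) (closed z∈states y∈)

  pump-or-closed : AF R → Pump ⊎ ∃[ I ] s₀ ∈ I × All (s₀ ⟶*_) I ×
                   (∀ {x y} → x ∈ I → y ∈ succs x → Any (y ~_) I)
  pump-or-closed af =
    Sum.map₂ (λ (I , s₀∈ , I* , closed) → I , s₀∈ , I* , λ x∈ y∈ → [ id , (λ ()) ]′ (closed x∈ y∈))
      (explore s₀ [] ε [] (start (AF⇒Bar af inj₁)))
    where
    start : Bar [] → Bar (s₀ ∷ [])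
    start (bar f) = f s₀ λ ()

-- Live states of an automaton

module Liveness {k : ℕ} (D : DFA (Fin k)) where
  open DFA D

  Live : Fin #states → Set
  Live d = ∃[ v ] foldl δ d v Subset.∈ final

  -- With equality for both relations and `⊥` for `Pump`, the exploration always returns a finite
  -- set: the states reachable from `d`. It remains to search it for a final state.
  live? : ∀ d → Dec (Live d)
  live? d = decide (pump-or-closed AF-Fin)
    where
    successors : Fin #states → List (Fin #states)
    successors e = map (δ e) (allFin k)

    open Exploration successors {_~_ = _≡_} {R = _≡_} Fin._≟_ refl ⊥ d (λ _ _ → inj₁ ∘ sym)

    word : ∀ {x y} → x ⟶* y → ∃[ v ] foldl δ x v ≡ y
    word ε = [] , refl
    word {x} (y∈ ◅ ys) with ∈-map⁻ (δ x) y∈ | word ys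
    ... | a , _ , refl | v , eq = a ∷ v , eq

    decide : ⊥ ⊎ ∃[ I ] d ∈ I × All (d ⟶*_) I ×
             (∀ {x y} → x ∈ I → y ∈ successors x → y ∈ I) → Dec (Live d)
    decide (inj₂ (I , d∈ , I* , closed)) with Any.any? (Subset._∈? final) I
    ... | yes p = yes (accept (find p))
      where
      accept : ∃[ x ] x ∈ I × x Subset.∈ final → Live d
      accept (x , x∈ , x-final) with word (All.lookup I* x∈)
      ... | v , refl = v , x-final
    ... | no ¬p = no λ (v , v-final) → ¬p (lose (stays v d∈) v-final)
      where
      stays : ∀ v {x} → x ∈ I → foldl δ x v ∈ I
      stays []      x∈ = x∈
      stays (a ∷ v) x∈ = stays v (closed x∈ (∈-map⁺ (δ _) (∈-allFin a)))

-- Labelled runs and queues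

data Runs {S E : Set} (T : S → E → S → Set) : S → List E → S → Set where
  []  : ∀ {s} → Runs T s [] s
  _∷_ : ∀ {s s′ t α σ} → T s α s′ → Runs T s′ σ t → Runs T s (α ∷ σ) t

module _ {S E : Set} {T : S → E → S → Set} where

  _++ʳ_ : ∀ {s t u σ τ} → Runs T s σ t → Runs T t τ u → Runs T s (σ ++ τ) u
  []      ++ʳ r′ = r′
  (e ∷ r) ++ʳ r′ = e ∷ (r ++ʳ r′)

data Event (A : Set) : Set where
  send receive : A → Event A

sentLetter : ∀ {A} → Maybe (Event A) → Maybe A
sentLetter (just (send a))    = just a
sentLetter (just (receive _)) = nothing
sentLetter nothing            = nothing

sent : ∀ {A} → List (Maybe (Event A)) → List A
sent = mapMaybe sentLetter

-- A channel idles while the machine acts on another channel.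
data QueueStep {A : Set} : List A → Maybe (Event A) → List A → Set where
  idle    : ∀ {w} → QueueStep w nothing w
  send    : ∀ {w a} → QueueStep w (just (send a)) (w ∷ʳ a)
  receive : ∀ {w a} → QueueStep (a ∷ w) (just (receive a)) w

-- Positions of letters in w₁, …, wₙ.  The position next p follows p cyclically
-- in the word that contains p, and rank p is the number of that word.
record Positions (A : Set) : Set₁ where
  field
    Pos       : Set
    elements  : List Pos
    ∈elements : ∀ p → p ∈ elements
    next      : Pos → Pos
    rank      : Pos → ℕ
    rank-next : ∀ p → rank (next p) ≡ rank p
    letter    : Pos → A

  _≟ₚ_ : DecidableEquality Pos
  p ≟ₚ q = Dec.map′ (index-injective ∈elements) (cong (Any.index ∘ ∈elements))
                    (Any.index (∈elements p) Fin.≟ Any.index (∈elements q))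

  -- nothing is the position expected before the first letter.
  level : Maybe Pos → ℕ
  level nothing  = 0
  level (just p) = suc (rank p)

  Expects : Maybe Pos → Pos → Set
  Expects g p = g ≡ just p

  -- A jump may leave a word anywhere and land anywhere in a later one. Trails thus need not spell
  -- words of w₁* ⋯ wₙ*; membership in the language is left to the automaton.
  Allows : Maybe Pos → Pos → Set
  Allows g p = g ≡ just p ⊎ level g < level (just p)

  data Trail (N : Maybe Pos → Pos → Set) : Maybe Pos → List Pos → Maybe Pos → Set where
    []  : ∀ {g} → Trail N g [] g
    _∷_ : ∀ {g g′ p l} → N g p → Trail N (just (next p)) l g′ → Trail N g (p ∷ l) g′

  Path : Maybe Pos → List Pos → Maybe Pos → Set
  Path = Trail Expects

  module _ {N : Maybe Pos → Pos → Set} where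

    _++ᵗ_ : ∀ {g g′ g″ l m} → Trail N g l g′ → Trail N g′ m g″ → Trail N g (l ++ m) g″
    []      ++ᵗ u = u
    (n ∷ t) ++ᵗ u = n ∷ (t ++ᵗ u)

    splitᵗ : ∀ l {m g g″} → Trail N g (l ++ m) g″ → ∃[ g′ ] Trail N g l g′ × Trail N g′ m g″
    splitᵗ []      t       = _ , [] , t
    splitᵗ (p ∷ l) (n ∷ t) with splitᵗ l t
    ... | g′ , t₁ , t₂ = g′ , n ∷ t₁ , t₂

  Path-end : ∀ {g l e e′} → Path g l e → Path g l e′ → e ≡ e′
  Path-end []      []      = refl
  Path-end (_ ∷ t) (_ ∷ u) = Path-end t u

  Path-determined : ∀ {g l m e e′} → Path g l e → Path g m e′ → length l ≡ length m → l ≡ m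
  Path-determined []         []         _  = refl
  Path-determined (refl ∷ t) (refl ∷ u) eq = cong (_ ∷_) (Path-determined t u (ℕ.suc-injective eq))

  Allows⇒level≤ : ∀ {g p} → Allows g p → level g ≤ level (just p)
  Allows⇒level≤ (inj₁ refl) = ℕ.≤-refl
  Allows⇒level≤ (inj₂ g<p)  = ℕ.<⇒≤ g<p

  level-next≤ : ∀ {p n} → level (just (next p)) ≤ n → level (just p) ≤ n
  level-next≤ {p} = subst (λ r → suc r ≤ _) (rank-next p)

  Trail⇒level≤ : ∀ {g l g′} → Trail Allows g l g′ → level g ≤ level g′
  Trail⇒level≤ []      = ℕ.≤-refl
  Trail⇒level≤ (n ∷ t) = ℕ.≤-trans (Allows⇒level≤ n) (level-next≤ (Trail⇒level≤ t))

  Trail⇒All-level≤ : ∀ {g l g′} → Trail Allows g l g′ → All (λ p → level g ≤ level (just p)) l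
  Trail⇒All-level≤ []      = []
  Trail⇒All-level≤ (n ∷ t) = Allows⇒level≤ n ∷
    All.map (ℕ.≤-trans (Allows⇒level≤ n) ∘ level-next≤) (Trail⇒All-level≤ t)

  -- Leaving a word increases the rank for good.
  flat⇒Path : ∀ {g l g′} → Trail Allows g l g′ → level g′ ≤ level g → Path g l g′
  flat⇒Path []                     _    = []
  flat⇒Path (_∷_ {p = p} n t) g′≤g = expects n ∷ flat⇒Path t
    (ℕ.≤-trans g′≤g (ℕ.≤-trans (Allows⇒level≤ n) (ℕ.≤-reflexive (cong suc (sym (rank-next p))))))
    where
    expects : Allows _ p → Expects _ p
    expects (inj₁ eq)  = eq
    expects (inj₂ g<p) =
      contradiction (ℕ.≤-trans (level-next≤ (Trail⇒level≤ t)) g′≤g) (ℕ.<⇒≱ g<p)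


-- Positions for a list of words, and trails for w₁* ⋯ wₙ*

successor : ∀ {n} → Fin (suc n) → Maybe (Fin (suc n))
successor {zero}  zero    = nothing
successor {suc n} zero    = just (suc zero)
successor {suc n} (suc i) = Maybe.map suc (successor i)

data Ascent {n : ℕ} : Fin (suc n) → List (Fin (suc n)) → Set where
  last : ∀ {i} → successor i ≡ nothing → Ascent i (i ∷ [])
  _∷_  : ∀ {i j l} → successor i ≡ just j → Ascent j l → Ascent i (i ∷ l)

ascent : ∀ n → Ascent {n} zero (allFin (suc n))
ascent zero    = last refl
ascent (suc n) = refl ∷ subst (Ascent (suc zero)) (map-tabulate id suc) (shift (ascent n))
  where
  shift : ∀ {i l} → Ascent {n} i l → Ascent (suc i) (map suc l)
  shift (last eq) = last (cong (Maybe.map suc) eq)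
  shift (eq ∷ a)  = cong (Maybe.map suc) eq ∷ shift a

module _ {A : Set} where

  positions : List (List A) → Positions A
  positions [] = record
    { Pos = ⊥ ; elements = [] ; ∈elements = λ () ; next = λ () ; rank = λ () ; rank-next = λ ()
    ; letter = λ () }
  positions ([] ∷ ws)       = positions ws
  positions ((a ∷ w) ∷ ws) = record
    { Pos       = Fin (suc (length w)) ⊎ Pos
    ; elements  = map inj₁ (allFin (suc (length w))) ++ map inj₂ elements
    ; ∈elements = Sum.[ ∈-++⁺ˡ ∘ ∈-map⁺ inj₁ ∘ ∈-allFin
                  , ∈-++⁺ʳ (map inj₁ (allFin (suc (length w)))) ∘ ∈-map⁺ inj₂ ∘ ∈elements ]
    -- `successor` fails only at the last letter, where the default `zero` closes the cycle.
    ; next      = Sum.map (Maybe.fromMaybe zero ∘ successor) next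
    ; rank      = [ (λ _ → 0) , suc ∘ rank ]′
    ; rank-next = Sum.[ (λ _ → refl) , cong suc ∘ rank-next ]
    ; letter    = [ lookup (a ∷ w) , letter ]′
    }
    where
    open Positions (positions ws)

  open Positions using (Trail; Allows; Path; Expects; []; _∷_; letter)

  -- The `k` copies of the first word are `k` laps around its cycle, and the spelling of the rest is
  -- moved one rank up. If `k` is 0, that spelling still starts from `nothing`; otherwise a jump
  -- leads into it.
  spell : ∀ {ws u} → All (_≢ []) ws → StarProduct ws u →
          ∃[ l ] ∃[ e ] Trail (positions ws) (Allows (positions ws)) nothing l e ×
          map (letter (positions ws)) l ≡ u
  spell [] [] = [] , nothing , [] , refl
  spell {[] ∷ ws} (w≢ ∷ _) (k ∷ _) = contradiction refl w≢
  spell {(a ∷ w) ∷ ws} (_ ∷ ws≢) (k ∷ u) with spell ws≢ u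
  ... | l , e , T , refl = iterate k
    where
    module P = Positions (positions ((a ∷ w) ∷ ws))
    module P′ = Positions (positions ws)
    lap : List P.Pos
    lap = map inj₁ (allFin (suc (length w)))

    onward : ∀ {g l e} → P′.Trail P′.Allows g l e →
             P.Trail P.Allows (Maybe.map inj₂ g) (map inj₂ l) (Maybe.map inj₂ e)
    onward [] = []
    onward (inj₁ refl ∷ T) = inj₁ refl ∷ onward T
    onward (_∷_ {g = nothing} (inj₂ g<p) T) = inj₂ (s≤s z≤n) ∷ onward T
    onward (_∷_ {g = just _} (inj₂ g<p) T) = inj₂ (s≤s g<p) ∷ onward T

    enter : ∀ {l e} → P′.Trail P′.Allows nothing l e →
            ∃[ e′ ] P.Trail P.Allows (just (inj₁ zero)) (map inj₂ l) e′
    enter [] = _ , []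
    enter (_ ∷ T) = _ , inj₂ (s≤s (s≤s z≤n)) ∷ onward T

    around : ∀ {i l} → Ascent i l → P.Path (just (inj₁ i)) (map inj₁ l) (just (inj₁ zero))
    around (last eq) = refl ∷
      subst (λ m → P.Path (just (inj₁ (Maybe.fromMaybe zero m))) _ _) (sym eq) []
    around (eq ∷ s)  = refl ∷
      subst (λ m → P.Path (just (inj₁ (Maybe.fromMaybe zero m))) _ _) (sym eq) (around s)

    relax : ∀ {g l e} → P.Path g l e → P.Trail P.Allows g l e
    relax []       = []
    relax (eq ∷ t) = inj₁ eq ∷ relax t

    laps : ∀ k → P.Trail P.Allows (just (inj₁ zero)) (concat (replicate k lap)) (just (inj₁ zero))
    laps zero    = []
    laps (suc k) = relax (around (ascent (length w))) P.++ᵗ laps k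

    begin : ∀ {p m e} → P.Trail P.Allows (just (inj₁ zero)) (p ∷ m) e → P.Trail P.Allows nothing (p ∷ m) e
    begin (_ ∷ t) = inj₂ (s≤s z≤n) ∷ t

    letters-lap : map P.letter lap ≡ a ∷ w
    letters-lap = trans (sym (map-∘ (allFin (suc (length w)))))
      (trans (map-tabulate id (lookup (a ∷ w))) (tabulate-lookup (a ∷ w)))

    letters-laps : ∀ k → map P.letter (concat (replicate k lap)) ≡ concat (replicate k (a ∷ w))
    letters-laps zero    = refl
    letters-laps (suc k) = trans (map-++ P.letter lap _) (cong₂ _++_ letters-lap (letters-laps k))

    iterate : ∀ k → ∃[ m ] ∃[ e′ ] P.Trail P.Allows nothing m e′ ×
              map P.letter m ≡ concat (replicate k (a ∷ w)) ++ map P′.letter l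
    iterate zero    = map inj₂ l , _ , onward T , sym (map-∘ l)
    iterate (suc k) = concat (replicate (suc k) lap) ++ map inj₂ l , _ ,
      begin (laps (suc k) P.++ᵗ proj₂ (enter T)) ,
      trans (map-++ P.letter (concat (replicate (suc k) lap)) (map inj₂ l))
            (cong₂ _++_ (letters-laps (suc k)) (sym (map-∘ l)))

-- A single channel: annotated runs and their repetition

module Channel {k : ℕ} (D : DFA (Fin k)) (positions : Positions (Fin k)) where
  open DFA D
  open Liveness D
  open Positions positions

  Label : Set
  Label = Maybe (Event (Fin k))

  -- The queue is stored as the positions of its letters, chosen when they are
  -- sent; tail is the position expected next.
  record State : Set where
    constructor ⟨_,_,_⟩
    field
      tail  : Maybe Pos
      state : Fin #states
      queue : List Pos
  open State public

  size : State → ℕ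
  size = length ∘ queue

  contents : State → List (Fin k)
  contents = map letter ∘ queue

  -- A send guesses its position. Liveness of the new automaton state keeps the word sent so far a
  -- prefix of an accepted word.
  data LocalStep : State → Label → State → Set where
    idle    : ∀ {s} → LocalStep s nothing s
    send    : ∀ {g d w p a} → Allows g p → letter p ≡ a → Live (δ d a) →
              LocalStep ⟨ g , d , w ⟩ (just (send a)) ⟨ just (next p) , δ d a , w ∷ʳ p ⟩
    receive : ∀ {g d w p a} → letter p ≡ a →
              LocalStep ⟨ g , d , p ∷ w ⟩ (just (receive a)) ⟨ g , d , w ⟩

  LocalRun : State → List Label → State → Set
  LocalRun = Runs LocalStep

  sentPos receivedPos : ∀ {s τ t} → LocalRun s τ t → List Pos
  sentPos []                        = []
  sentPos (idle ∷ r)                = sentPos r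
  sentPos (send {p = p} _ _ _ ∷ r)  = p ∷ sentPos r
  sentPos (receive _ ∷ r)           = sentPos r
  receivedPos []                       = []
  receivedPos (idle ∷ r)               = receivedPos r
  receivedPos (send _ _ _ ∷ r)         = receivedPos r
  receivedPos (receive {p = p} _ ∷ r)  = p ∷ receivedPos r

  sentPos-trail : ∀ {s τ t} (r : LocalRun s τ t) → Trail Allows (tail s) (sentPos r) (tail t)
  sentPos-trail []                 = []
  sentPos-trail (idle ∷ r)         = sentPos-trail r
  sentPos-trail (send g≤p _ _ ∷ r) = g≤p ∷ sentPos-trail r
  sentPos-trail (receive _ ∷ r)    = sentPos-trail r

  queue-balance : ∀ {s τ t} (r : LocalRun s τ t) →
                  queue s ++ sentPos r ≡ receivedPos r ++ queue t
  queue-balance []         = ++-identityʳ _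
  queue-balance (idle ∷ r) = queue-balance r
  queue-balance (send {w = w} {p = p} _ _ _ ∷ r) =
    trans (sym (∷ʳ-++ w p (sentPos r))) (queue-balance r)
  queue-balance (receive _ ∷ r) = cong (_ ∷_) (queue-balance r)

  replay-sends : ∀ {s τ t} (r : LocalRun s τ t) → receivedPos r ≡ [] → ∀ v →
                 LocalRun ⟨ tail s , state s , v ⟩ τ ⟨ tail t , state t , v ++ sentPos r ⟩
  replay-sends [] _ v = subst (λ u → LocalRun _ [] ⟨ _ , _ , u ⟩) (sym (++-identityʳ v)) []
  replay-sends (idle ∷ r) none v = idle ∷ replay-sends r none v
  replay-sends (send {p = p} g≤p eq live ∷ r) none v = send g≤p eq live ∷
    subst (λ u → LocalRun _ _ ⟨ _ , _ , u ⟩) (∷ʳ-++ v p (sentPos r)) (replay-sends r none (v ∷ʳ p))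
  replay-sends (receive _ ∷ r) () v

  -- Both queues spell the same periodic word, so a longer queue offers at
  -- least the letters that the run receives.
  replay-periodic :
    ∀ {s τ t h e e′} (r : LocalRun s τ t) v →
    Path h (queue s ++ sentPos r) e → Path h (v ++ sentPos r) e′ → size s ≤ length v →
    ∃[ v′ ] LocalRun ⟨ tail s , state s , v ⟩ τ ⟨ tail t , state t , v′ ⟩ ×
            v ++ sentPos r ≡ receivedPos r ++ v′
  replay-periodic [] v P P′ s≤v = v , [] , ++-identityʳ v
  replay-periodic (idle ∷ r) v P P′ s≤v with replay-periodic r v P P′ s≤v
  ... | v′ , r′ , eq = v′ , idle ∷ r′ , eq
  replay-periodic (send {w = w} {p = p} g≤p l live ∷ r) v P P′ s≤v
    with replay-periodic r (v ∷ʳ p)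
           (subst (λ u → Path _ u _) (sym (∷ʳ-++ w p (sentPos r))) P)
           (subst (λ u → Path _ u _) (sym (∷ʳ-++ v p (sentPos r))) P′)
           (subst₂ _≤_ (sym (length-++-sucʳ w p [])) (sym (length-++-sucʳ v p []))
             (s≤s (subst₂ _≤_ (cong length (sym (++-identityʳ w)))
                              (cong length (sym (++-identityʳ v))) s≤v)))
  ... | v′ , r′ , eq = v′ , send g≤p l live ∷ r′ , trans (sym (∷ʳ-++ v p (sentPos r))) eq
  replay-periodic (receive l ∷ r) [] P P′ ()
  replay-periodic (receive l ∷ r) (p ∷ v) (refl ∷ P) (refl ∷ P′) (s≤s s≤v)
    with replay-periodic r v P P′ s≤v
  ... | v′ , r′ , eq = v′ , receive l ∷ r′ , cong (p ∷_) eq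

  below? : ∀ n p → Dec (level (just p) < n)
  below? n p = level (just p) ℕ.<? n

  below : Maybe Pos → List Pos → ℕ
  below g w = length (filter (below? (level g)) w)

  below-++ : ∀ g v w → below g (v ++ w) ≡ below g v + below g w
  below-++ g v w = trans (cong length (filter-++ (below? (level g)) v w))
                         (length-++ (filter (below? (level g)) v))

  -- For a run from `s` to `t`, equal tails confine the letters sent to one word, equal heads fix
  -- the phase of those received, `below≤` forbids receiving from words before that of the tail, and
  -- `size≤` keeps the queue long enough to repeat the run.
  record _≼_ (s t : State) : Set where
    constructor mk≼
    field
      tail≡  : tail s ≡ tail t
      state≡ : state s ≡ state t
      head≡  : head (queue s) ≡ head (queue t)
      below≤ : below (tail s) (queue s) ≤ below (tail t) (queue t)
      size≤  : size s ≤ size t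

  AF-≼ : AF _≼_
  AF-≼ = AF-mono (λ (a , b , c , d , e) → mk≼ a b c d e)
    (AF-on tail AF-Maybe AF-∩ AF-on state AF-Fin AF-∩ AF-on (head ∘ queue) AF-Maybe AF-∩
     AF-on (λ s → below (tail s) (queue s)) AF-≤ AF-∩ AF-on size AF-≤)
    where
    AF-Maybe : AF {Maybe Pos} _≡_
    AF-Maybe = AF-enumerated {xs = nothing ∷ map just elements}
      λ { nothing → here refl ; (just p) → there (∈-map⁺ just (∈elements p)) }

  _≟ₘ_ : DecidableEquality (Maybe Pos)
  _≟ₘ_ = Maybe.≡-dec _≟ₚ_

  _≼?_ : Decidable _≼_
  s ≼? t = Dec.map′ (λ (a , b , c , d , e) → mk≼ a b c d e) (λ (mk≼ a b c d e) → a , b , c , d , e)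
    (tail s ≟ₘ tail t ×-dec state s Fin.≟ state t ×-dec head (queue s) ≟ₘ head (queue t) ×-dec
     below (tail s) (queue s) ℕ.≤? below (tail t) (queue t) ×-dec size s ℕ.≤? size t)

  -- The equation in `step` says, without subtraction, that every repetition changes the queue
  -- length by as much as the original run. By `same`, a run without growth is a loop.
  record Repeatable (s : State) (τ : List Label) (t : State) : Set₁ where
    field
      Inv  : State → Set
      base : Inv s
      step : ∀ {v} → Inv v → ∃[ v′ ] LocalRun v τ v′ × Inv v′ × size v′ + size s ≡ size v + size t
      same : size s ≡ size t → s ≡ t

  size-balance : ∀ (v y x v′ : List Pos) → v ++ y ≡ x ++ v′ →
                 length v + length y ≡ length x + length v′
  size-balance v y x v′ eq =
    trans (sym (length-++ v)) (trans (cong length eq) (length-++ x))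

  -- The queue does not restrict a run that receives nothing, so tail and automaton state form the
  -- whole invariant.
  send-only : ∀ {s τ t} (r : LocalRun s τ t) → s ≼ t → receivedPos r ≡ [] → Repeatable s τ t
  send-only {⟨ g , d , w ⟩} {τ} {⟨ g , d , w′ ⟩} r (mk≼ refl refl _ _ _) none = record
    { Inv  = λ v → tail v ≡ g × state v ≡ d
    ; base = refl , refl
    ; step = λ { {⟨ _ , _ , v ⟩} (refl , refl) →
        _ , replay-sends r none v , (refl , refl) , grows v }
    ; same = same
    }
    where
    balance : w ++ sentPos r ≡ w′
    balance = trans (queue-balance r) (cong (_++ w′) none)
    grows : ∀ v → length (v ++ sentPos r) + length w ≡ length v + length w′
    grows v = begin
      length (v ++ sentPos r) + length w           ≡⟨ cong (_+ length w) (length-++ v) ⟩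
      length v + length (sentPos r) + length w     ≡⟨ rearrange (length v) (length (sentPos r)) (length w) ⟩
      length v + (length w + length (sentPos r))   ≡⟨ cong (length v +_) (length-++ w) ⟨
      length v + length (w ++ sentPos r)           ≡⟨ cong (λ u → length v + length u) balance ⟩
      length v + length w′                         ∎
      where
      open ≡-Reasoning
      rearrange : ∀ a b c → a + b + c ≡ a + (c + b)
      rearrange = solve-∀
    same : length w ≡ length w′ → ⟨ g , d , w ⟩ ≡ ⟨ g , d , w′ ⟩
    same eq = cong ⟨ g , d ,_⟩ (proper-prefix (sentPos r) balance)
      where
      proper-prefix : ∀ y → w ++ y ≡ w′ → w ≡ w′
      proper-prefix []      bal = trans (sym (++-identityʳ w)) bal
      proper-prefix (p ∷ y) bal = contradiction (trans eq (cong length (sym bal)))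
        (ℕ.<⇒≢ (subst (length w <_) (sym (length-++-sucʳ w p y)) (s≤s (length-++-≤ˡ w))))

  -- Here `h` is the phase at the queue head. The letters received lead from `h` back to `h` and
  -- those sent from the tail back to the tail, so each repetition again leaves a queue running from
  -- `h` to the tail.
  periodic : ∀ {s τ t h} (r : LocalRun s τ t) → s ≼ t →
             Path h (receivedPos r) h → Path h (queue s) (tail s) →
             Path (tail s) (sentPos r) (tail s) → Repeatable s τ t
  periodic {⟨ g , d , w ⟩} {τ} {⟨ g , d , w′ ⟩} {h} r (mk≼ refl refl _ _ w≤w′) Px Pw Py = record
    { Inv  = Inv
    ; base = refl , refl , Pw , ℕ.≤-refl
    ; step = step
    ; same = λ eq → cong ⟨ g , d ,_⟩ (Path-determined Pw (after-received Pw (queue-balance r)) eq)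
    }
    where
    x y : List Pos
    x = receivedPos r
    y = sentPos r
    Inv : State → Set
    Inv v = tail v ≡ g × state v ≡ d × Path h (queue v) g × length w ≤ size v
    after-received : ∀ {v v′} → Path h v g → v ++ y ≡ x ++ v′ → Path h v′ g
    after-received {v} {v′} Pv eq with splitᵗ x (subst (λ u → Path h u g) eq (Pv ++ᵗ Py))
    ... | e , Px′ , Pv′ = subst (λ e → Path e v′ g) (Path-end Px′ Px) Pv′
    -- The two balances are added crosswise, and the lengths `x` and `y` that they share cancel.
    exchange : ∀ a b x y c d → a + y ≡ x + c → b + y ≡ x + d → c + b ≡ a + d
    exchange a b x y c d p q = ℕ.+-cancelˡ-≡ (x + y) _ _ (begin
      x + y + (c + b)    ≡⟨ left x y c b ⟩
      (x + c) + (b + y)  ≡⟨ cong₂ _+_ (sym p) q ⟩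
      (a + y) + (x + d)  ≡⟨ right x y a d ⟩
      x + y + (a + d)    ∎)
      where
      open ≡-Reasoning
      left : ∀ x y c b → x + y + (c + b) ≡ (x + c) + (b + y)
      left = solve-∀
      right : ∀ x y a d → (a + y) + (x + d) ≡ x + y + (a + d)
      right = solve-∀
    step : ∀ {v} → Inv v →
           ∃[ v′ ] LocalRun v τ v′ × Inv v′ × size v′ + length w ≡ size v + length w′
    step {⟨ g , d , v ⟩} (refl , refl , Pv , w≤v)
      with replay-periodic r v (Pw ++ᵗ Py) (Pv ++ᵗ Py) w≤v
    ... | v′ , r′ , eq = ⟨ g , d , v′ ⟩ , r′ , (refl , refl , after-received Pv eq , w≤v′) , grows
      where
      grows : length v′ + length w ≡ length v + length w′
      grows = exchange (length v) (length w) (length x) (length y) (length v′) (length w′)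
        (size-balance v y x v′ eq) (size-balance w y x w′ (queue-balance r))
      w≤v′ : length w ≤ length v′
      w≤v′ = ℕ.+-cancelʳ-≤ (length w) _ _
        (subst (length w + length w ≤_) (sym grows) (ℕ.+-mono-≤ w≤v w≤w′))

  Coherent : State → Set
  Coherent s = ∃[ e ] Trail Allows e (queue s) (tail s)

  -- If a letter is received although ≼ holds, the queue head and the tail lie
  -- in the same word: the positions below the level of the tail are never
  -- sent again, so receiving one of them decreases their number.
  repeatable : ∀ {s τ t} → Coherent s → LocalRun s τ t → s ≼ t → Repeatable s τ t
  repeatable {⟨ g , d , w ⟩} {τ} {⟨ g , d , w′ ⟩} (e , W) r s≼t@(mk≼ refl refl head≡ below≤ _)
    = analyse w w′ x refl refl refl head≡ bal
    where
    x y : List Pos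
    x = receivedPos r
    y = sentPos r
    Y : Trail Allows g y g
    Y = sentPos-trail r
    Py : Path g y g
    Py = flat⇒Path Y ℕ.≤-refl
    bal : w ++ y ≡ x ++ w′
    bal = queue-balance r

    none-below : below g y ≡ 0
    none-below = cong length (filter-none (below? (level g)) (All.map ℕ.≤⇒≯ (Trail⇒All-level≤ Y)))

    -- `x` is computed from `r`, so the case split is made on copies tied by equations.
    analyse : ∀ v v′ x′ → v ≡ w → v′ ≡ w′ → x′ ≡ x → head v ≡ head v′ → v ++ y ≡ x′ ++ v′ →
              Repeatable ⟨ g , d , w ⟩ τ ⟨ g , d , w′ ⟩
    analyse _ _ [] _ _ none _ _ = send-only r s≼t (sym none)
    -- Between two empty queues, the letters received are exactly those sent, so both form a loop at
    -- `g`.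
    analyse [] [] (p ∷ x′) refl refl eq _ y≡ = periodic {h = g} r s≼t
      (subst (λ u → Path g u g) (trans y≡ (trans (++-identityʳ (p ∷ x′)) eq)) Py) [] Py
    analyse (p ∷ w₁) (_ ∷ w₁′) (_ ∷ x′) refl refl eq refl vy≡
      with refl ← ∷-injectiveˡ vy≡
      with splitᵗ (p ∷ x′) (subst (λ u → Trail Allows e u g) vy≡ (W ++ᵗ Y))
    ... | e′ , _ ∷ X , E ∷ _ = periodic {h = just p} r s≼t
            (subst (λ u → Path (just p) u (just p)) eq
              (refl ∷ flat⇒Path (subst (Trail Allows _ x′) e′≡p X) p≤next))
            (refl ∷ flat⇒Path (tailᵗ W) (ℕ.≤-trans g≤p p≤next))
            Py
      where
      tailᵗ : ∀ {a b p l} → Trail Allows a (p ∷ l) b → Trail Allows (just (next p)) l b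
      tailᵗ (_ ∷ t) = t
      p≤next : level (just p) ≤ level (just (next p))
      p≤next = ℕ.≤-reflexive (cong suc (sym (rank-next p)))
      -- By `E`, the new head `p` may follow the received letters. These begin with `p` and levels
      -- never fall, so `p` is not reached by a jump and must be the position expected.
      e′≡p : e′ ≡ just p
      e′≡p = [ id , (λ e′<p → contradiction (level-next≤ (Trail⇒level≤ X)) (ℕ.<⇒≱ e′<p)) ]′ E
      received-below : level (just p) < level g → below g w′ < below g w
      received-below p<g = begin-strict
        below g w′               <⟨ s≤s (ℕ.m≤n+m _ (below g x′)) ⟩
        suc (below g x′) + below g w′
          ≡⟨ cong (_+ below g w′) (cong length (filter-accept (below? (level g)) p<g)) ⟨
        below g (p ∷ x′) + below g w′ ≡⟨ cong (λ u → below g u + below g w′) eq ⟩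
        below g x + below g w′ ≡⟨ below-++ g x w′ ⟨
        below g (x ++ w′)        ≡⟨ cong (below g) bal ⟨
        below g (w ++ y)         ≡⟨ below-++ g w y ⟩
        below g w + below g y  ≡⟨ cong (below g w +_) none-below ⟩
        below g w + 0          ≡⟨ ℕ.+-identityʳ _ ⟩
        below g w                ∎
        where open ℕ.≤-Reasoning
      g≤p : level g ≤ level (just p)
      g≤p = ℕ.≮⇒≥ λ p<g → ℕ.≤⇒≯ below≤ (received-below p<g)

  sendable? : ∀ g d a p → Dec (Allows g p × letter p ≡ a × Live (δ d a))
  sendable? g d a p =
    (g ≟ₘ just p ⊎-dec level g ℕ.<? level (just p)) ×-dec letter p Fin.≟ a ×-dec live? (δ d a)

  successors : State → Label → List State
  successors s nothing = s ∷ []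
  successors ⟨ g , d , w ⟩ (just (send a)) =
    map (λ p → ⟨ just (next p) , δ d a , w ∷ʳ p ⟩) (filter (sendable? g d a) elements)
  successors ⟨ g , d , [] ⟩ (just (receive a)) = []
  successors ⟨ g , d , p ∷ w ⟩ (just (receive a)) with letter p Fin.≟ a
  ... | yes _ = ⟨ g , d , w ⟩ ∷ []
  ... | no  _ = []

  successors-sound : ∀ {s t} α → t ∈ successors s α → LocalStep s α t
  successors-sound nothing (here refl) = idle
  successors-sound {⟨ g , d , w ⟩} (just (send a)) t∈
    with p , p∈ , refl ← ∈-map⁻ _ t∈
    with _ , g≤p , l , live ← ∈-filter⁻ (sendable? g d a) {xs = elements} p∈ = send g≤p l live
  successors-sound {⟨ g , d , [] ⟩} (just (receive a)) ()
  successors-sound {⟨ g , d , p ∷ w ⟩} (just (receive a)) t∈ with letter p Fin.≟ a | t∈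
  ... | yes l | here refl = receive l

  successors-complete : ∀ {s α t} → LocalStep s α t → t ∈ successors s α
  successors-complete idle = here refl
  successors-complete (send {g} {d} {p = p} {a} g≤p l live) =
    ∈-map⁺ _ (∈-filter⁺ (sendable? g d a) (∈elements p) (g≤p , l , live))
  successors-complete (receive {p = p} {a} l) with letter p Fin.≟ a
  ... | yes _ = here refl
  ... | no ¬l = contradiction l ¬l

  start-state : State
  start-state = ⟨ nothing , start , [] ⟩

  QueueRun : List (Fin k) → List Label → List (Fin k) → Set
  QueueRun = Runs QueueStep

  erase-step : ∀ {s α t} → LocalStep s α t → QueueStep (contents s) α (contents t)
  erase-step idle = idle
  erase-step (send {w = w} {p = p} _ refl _) =
    subst (QueueStep (map letter w) _) (sym (map-++ letter w (p ∷ []))) send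
  erase-step (receive refl) = receive

  erase : ∀ {s τ t} → LocalRun s τ t → QueueRun (contents s) τ (contents t)
  erase []      = []
  erase (e ∷ r) = erase-step e ∷ erase r

  run-state : ∀ {s τ t} → LocalRun s τ t → state t ≡ foldl δ (state s) (sent τ)
  run-state []                 = refl
  run-state (idle ∷ r)         = run-state r
  run-state (send _ _ _ ∷ r)   = run-state r
  run-state (receive _ ∷ r)    = run-state r

  run-live : ∀ {s τ t} → Live (state s) → LocalRun s τ t → Live (state t)
  run-live live []                  = live
  run-live live (idle ∷ r)          = run-live live r
  run-live live (send _ _ live′ ∷ r) = run-live live′ r
  run-live live (receive _ ∷ r)     = run-live live r

  -- Liveness is tested at each send; the assumption on `start` serves runs that send nothing on
  -- this channel.
  run-sound : ∀ {τ t} → Live start → LocalRun start-state τ t → Pref (Accepted D) (sent τ)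
  run-sound {τ} live r with run-live live r
  ... | v , v-final = v , subst (Subset._∈ final)
    (trans (cong (λ d → foldl δ d v) (run-state r)) (sym (foldl-++ δ start (sent τ) v))) v-final

  -- Starting from the empty queue, the queue is always a suffix of the positions sent, which form a
  -- trail.
  run-coherent : ∀ {τ t} → LocalRun start-state τ t → Coherent t
  run-coherent r
    with splitᵗ (receivedPos r)
           (subst (λ u → Trail Allows _ u _) (queue-balance r) (sentPos-trail r))
  ... | e , _ , T = e , T

  -- An accepted word extending what the run sends is fixed in advance: its spelling `l` supplies
  -- the position of each send, and its remainder witnesses liveness.
  lift : ∀ {u τ w} → QueueRun u τ w → ∀ v {g d U l e} → map letter U ≡ u →
         map letter l ≡ sent τ ++ v → Trail Allows g l e → foldl δ d (sent τ ++ v) Subset.∈ final →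
         ∃[ t ] LocalRun ⟨ g , d , U ⟩ τ t × contents t ≡ w
  lift [] v U≡ l≡ T acc = _ , [] , U≡
  lift (idle ∷ r) v U≡ l≡ T acc with lift r v U≡ l≡ T acc
  ... | t , r′ , t≡ = t , idle ∷ r′ , t≡
  lift (_∷_ {σ = σ} send r) v {U = U} {p ∷ l} refl l≡ (g≤p ∷ T) acc
    with refl ← ∷-injectiveˡ l≡
    with lift r v (map-++ letter U (p ∷ [])) (∷-injectiveʳ l≡) T acc
  ... | t , r′ , t≡ = t , send g≤p refl (sent σ ++ v , acc) ∷ r′ , t≡
  lift (receive ∷ r) v {U = p ∷ U} refl l≡ T acc with lift r v refl l≡ T acc
  ... | t , r′ , t≡ = t , receive refl ∷ r′ , t≡

  Spells : List (Fin k) → Set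
  Spells u = ∃[ l ] ∃[ e ] Trail Allows nothing l e × map letter l ≡ u

  run-complete : ∀ {τ w} → QueueRun [] τ w → (∀ {u} → Accepted D u → Spells u) →
                 Pref (Accepted D) (sent τ) → ∃[ t ] LocalRun start-state τ t × contents t ≡ w
  run-complete r spells (v , acc) with spells acc
  ... | l , e , T , l≡ = lift r v refl l≡ T acc

uncons : ∀ {S E} {T : S → E → S → Set} {s α σ t} → Runs T s (α ∷ σ) t →
         ∃[ s′ ] T s α s′ × Runs T s′ σ t
uncons (e ∷ r) = _ , e , r

Runs-[] : ∀ {S E} {T : S → E → S → Set} {s t} → Runs T s [] t → s ≡ t
Runs-[] [] = refl

choices : ∀ {n} {F : Fin n → Set} → (∀ i → List (F i)) → List (∀ i → F i)
choices {zero}  xs = (λ ()) ∷ []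
choices {suc n} {F} xs = cartesianProductWith cons (xs zero) (choices (xs ∘ suc))
  where
  cons : F zero → (∀ i → F (suc i)) → ∀ i → F i
  cons x f zero    = x
  cons x f (suc i) = f i

choices-sound : ∀ {n} {F : Fin n → Set} (xs : ∀ i → List (F i)) {f} → f ∈ choices xs → ∀ i → f i ∈ xs i
choices-sound {suc n} xs f∈ i
  with ∈-cartesianProductWith⁻ _ (xs zero) (choices (xs ∘ suc)) f∈
choices-sound {suc n} xs f∈ zero    | _ , _ , x∈ , g∈ , refl = x∈
choices-sound {suc n} xs f∈ (suc i) | _ , _ , x∈ , g∈ , refl = choices-sound (xs ∘ suc) g∈ i

-- Only a pointwise copy of `f` is listed, which is why the exploration covers successors up to
-- `_~_`.
choices-complete : ∀ {n} {F : Fin n → Set} (xs : ∀ i → List (F i)) (f : ∀ i → F i) →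
                   (∀ i → f i ∈ xs i) → ∃[ g ] g ∈ choices xs × ∀ i → f i ≡ g i
choices-complete {zero} xs f f∈ = _ , here refl , λ ()
choices-complete {suc n} xs f f∈ with choices-complete (xs ∘ suc) (f ∘ suc) (f∈ ∘ suc)
... | g , g∈ , f≗g = _ , ∈-cartesianProductWith⁺ _ (f∈ zero) g∈ , λ { zero → refl ; (suc i) → f≗g i }

-- Machine runs as a control run with one queue run per channel

module Machine (M : FIFOMachine) where
  open FIFOMachine M

  on : ∀ c → Act → Maybe (Event (Msg c))
  on c (d ! a) with d Fin.≟ c
  ... | yes refl = just (send a)
  ... | no  _    = nothing
  on c (d ¿ a) with d Fin.≟ c
  ... | yes refl = just (receive a)
  ... | no  _    = nothing

  on-! : ∀ c a → on c (c ! a) ≡ just (send a)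
  on-! c a with c Fin.≟ c
  ... | yes refl = refl
  ... | no  c≢c  = contradiction refl c≢c

  on-¿ : ∀ c a → on c (c ¿ a) ≡ just (receive a)
  on-¿ c a with c Fin.≟ c
  ... | yes refl = refl
  ... | no  c≢c  = contradiction refl c≢c

  on-!-other : ∀ {c d} a → c ≢ d → on c (d ! a) ≡ nothing
  on-!-other {c} {d} a c≢d with d Fin.≟ c
  ... | yes refl = contradiction refl c≢d
  ... | no  _    = refl

  on-¿-other : ∀ {c d} a → c ≢ d → on c (d ¿ a) ≡ nothing
  on-¿-other {c} {d} a c≢d with d Fin.≟ c
  ... | yes refl = contradiction refl c≢d
  ... | no  _    = refl

  sentLetter-on : ∀ c α → sentLetter (on c α) ≡ sentOn c α
  sentLetter-on c (d ! a) with d Fin.≟ c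
  ... | yes refl = refl
  ... | no  _    = refl
  sentLetter-on c (d ¿ a) with d Fin.≟ c
  ... | yes refl = refl
  ... | no  _    = refl

  sent-on : ∀ c σ → sent (map (on c) σ) ≡ proj! c σ
  sent-on c σ = trans (mapMaybe-map sentLetter (on c) σ) (mapMaybe-cong (sentLetter-on c) σ)

  ControlStep : Q → Act → Q → Set
  ControlStep q α q′ = (q , α , q′) ∈ Δ

  ControlRun : Q → List Act → Q → Set
  ControlRun = Runs ControlStep

  Step⇒control : ∀ {q w α q′ w′} → Step (q , w) α (q′ , w′) → ControlStep q α q′
  Step⇒control (send t _ _)    = t
  Step⇒control (receive t _ _) = t

  Step⇒queue : ∀ {q w α q′ w′} → Step (q , w) α (q′ , w′) → ∀ c → QueueStep (w c) (on c α) (w′ c)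
  Step⇒queue (send {c = d} _ w′≡ others) c with d Fin.≟ c
  ... | yes refl = subst (QueueStep _ _) (sym w′≡) send
  ... | no  d≢c  = subst (QueueStep _ _) (sym (others c (d≢c ∘ sym))) idle
  Step⇒queue (receive {c = d} _ w≡ others) c with d Fin.≟ c
  ... | yes refl = subst (λ u → QueueStep u _ _) (sym w≡) receive
  ... | no  d≢c  = subst (QueueStep _ _) (sym (others c (d≢c ∘ sym))) idle

  Run⇒control : ∀ {q w σ q′ w′} → Run (q , w) σ (q′ , w′) → ControlRun q σ q′
  Run⇒control []      = []
  Run⇒control (s ∷ r) = Step⇒control s ∷ Run⇒control r

  Run⇒queue : ∀ {q w σ q′ w′} → Run (q , w) σ (q′ , w′) →
              ∀ c → Runs QueueStep (w c) (map (on c) σ) (w′ c)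
  Run⇒queue []      c = []
  Run⇒queue (s ∷ r) c = Step⇒queue s c ∷ Run⇒queue r c

  idle⁻ : ∀ {A} {w w′ : List A} → QueueStep w nothing w′ → w′ ≡ w
  idle⁻ idle = refl

  send⁻ : ∀ {A a} {w w′ : List A} → QueueStep w (just (send a)) w′ → w′ ≡ w ∷ʳ a
  send⁻ send = refl

  receive⁻ : ∀ {A a} {w w′ : List A} → QueueStep w (just (receive a)) w′ → w ≡ a ∷ w′
  receive⁻ receive = refl

  assemble-step : ∀ {q α q′ w w′} → ControlStep q α q′ → (∀ c → QueueStep (w c) (on c α) (w′ c)) →
                  Step (q , w) α (q′ , w′)
  assemble-step {α = c ! a} t e = send t
    (send⁻ (subst (λ l → QueueStep _ l _) (on-! c a) (e c)))
    (λ d d≢c → idle⁻ (subst (λ l → QueueStep _ l _) (on-!-other a d≢c) (e d)))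
  assemble-step {α = c ¿ a} t e = receive t
    (receive⁻ (subst (λ l → QueueStep _ l _) (on-¿ c a) (e c)))
    (λ d d≢c → idle⁻ (subst (λ l → QueueStep _ l _) (on-¿-other a d≢c) (e d)))

  assemble : ∀ {q σ q′} (w w′ : Contents) → ControlRun q σ q′ →
             (∀ c → Runs QueueStep (w c) (map (on c) σ) (w′ c)) →
             ∃[ w″ ] Run (q , w) σ (q′ , w″) × ∀ c → w″ c ≡ w′ c
  assemble w w′ [] r = w , [] , λ c → Runs-[] (r c)
  assemble w w′ (t ∷ ts) r
    with assemble (λ c → proj₁ (uncons (r c))) w′ ts (λ c → proj₂ (proj₂ (uncons (r c))))
  ... | w″ , r′ , eq = w″ , assemble-step t (λ c → proj₁ (proj₂ (uncons (r c)))) ∷ r′ , eq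

  sentOn-! : ∀ c a → sentOn c (c ! a) ≡ just a
  sentOn-! c a = trans (sym (sentLetter-on c (c ! a))) (cong sentLetter (on-! c a))

  sentOn-!-other : ∀ {c d} a → c ≢ d → sentOn c (d ! a) ≡ nothing
  sentOn-!-other {c} {d} a c≢d =
    trans (sym (sentLetter-on c (d ! a))) (cong sentLetter (on-!-other a c≢d))

  module _ (v : ∀ c → List (Msg c)) where

    sendAll : List Ch → List Act
    sendAll = concatMap (λ c → map (c !_) (v c))

    proj!-sendAll-∉ : ∀ {c} cs → All (c ≢_) cs → proj! c (sendAll cs) ≡ []
    proj!-sendAll-∉ [] [] = refl
    proj!-sendAll-∉ {c} (d ∷ cs) (c≢d ∷ c∉) =
      trans (mapMaybe-++ (sentOn c) (map (d !_) (v d)) (sendAll cs))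
      (cong₂ _++_ (mapMaybe-map-none (λ a → sentOn-!-other a c≢d) (v d)) (proj!-sendAll-∉ cs c∉))

    proj!-sendAll-∈ : ∀ {c cs} → Unique cs → c ∈ cs → proj! c (sendAll cs) ≡ v c
    proj!-sendAll-∈ {c} {d ∷ cs} (c∉ ∷ _) (here refl) =
      trans (mapMaybe-++ (sentOn c) (map (d !_) (v d)) (sendAll cs))
      (trans (cong₂ _++_ (mapMaybe-map-retract (sentOn-! c) (v c)) (proj!-sendAll-∉ cs c∉))
             (++-identityʳ (v c)))
    proj!-sendAll-∈ {c} {d ∷ cs} (d∉ ∷ u) (there c∈) =
      trans (mapMaybe-++ (sentOn c) (map (d !_) (v d)) (sendAll cs))
      (cong₂ _++_ (mapMaybe-map-none (λ a → sentOn-!-other a (All.lookup d∉ c∈ ∘ sym)) (v d))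
                  (proj!-sendAll-∈ u c∈))

  Pref⇒channelwise : ∀ (L : ∀ c → Language (Msg c)) σ → Pref (L ₍!₎) σ → ∀ c → Pref (L c) (proj! c σ)
  Pref⇒channelwise L σ (v , acc) c = proj! c v , subst (L c) (mapMaybe-++ (sentOn c) σ v) (acc c)

  -- The completions for different channels do not interfere: they are appended as blocks of sends,
  -- one channel after another. The suffix need not be executable.
  channelwise⇒Pref : ∀ (L : ∀ c → Language (Msg c)) σ → (∀ c → Pref (L c) (proj! c σ)) → Pref (L ₍!₎) σ
  channelwise⇒Pref L σ p = sendAll v (allFin _) , λ c → subst (L c)
    (sym (trans (mapMaybe-++ (sentOn c) σ (sendAll v (allFin _)))
                (cong (proj! c σ ++_) (proj!-sendAll-∈ v (allFin⁺ _) (∈-allFin c)))))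
    (proj₂ (p c))
    where
    v : ∀ c → List (Msg c)
    v c = proj₁ (p c)

  -- The annotated system and the decision

  module Decision (L : (c : Ch) → Language (Msg c))
    (L-inhabited : ∀ c → Satisfiable (L c)) (L-regular : ∀ c → Regular (L c))
    (L-bounded : ∀ c → Bounded (L c)) where

    ℛ : Config → Set
    ℛ = Reach (Pref (L ₍!₎))

    module C (c : Ch) = Channel (proj₁ (L-regular c)) (positions (proj₁ (L-bounded c)))

    GlobalState : Set
    GlobalState = Q × (∀ c → C.State c)

    _~_ _⊑_ : GlobalState → GlobalState → Set
    (q , f) ~ (q′ , f′) = q ≡ q′ × ∀ c → f c ≡ f′ c
    (q , f) ⊑ (q′ , f′) = q ≡ q′ × ∀ c → C._≼_ c (f c) (f′ c)

    _⊑?_ : Decidable _⊑_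
    (q , f) ⊑? (q′ , f′) = q Fin.≟ q′ ×-dec Fin.all? (λ c → C._≼?_ c (f c) (f′ c))

    AF-⊑ : AF _⊑_
    AF-⊑ = AF-on proj₁ AF-Fin AF-∩ AF-Π _ (λ c → AF-on (λ x → proj₂ x c) (C.AF-≼ c))

    GlobalStep : GlobalState → Act → GlobalState → Set
    GlobalStep (q , f) α (q′ , f′) = ControlStep q α q′ × ∀ c → C.LocalStep c (f c) (on c α) (f′ c)

    along : GlobalState → Q × Act × Q → List GlobalState
    along (q , f) (p , α , p′) with p Fin.≟ q
    ... | yes _ = map (p′ ,_) (choices λ c → C.successors c (f c) (on c α))
    ... | no  _ = []

    succs : GlobalState → List GlobalState
    succs x = concatMap (along x) Δ

    succs-sound : ∀ {x y} → y ∈ succs x → ∃[ α ] GlobalStep x α y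
    succs-sound {q , f} {y} y∈ with find (∈-concatMap⁻ (along (q , f)) {xs = Δ} y∈)
    ... | t , t∈ , y∈′ = α-step t t∈ y∈′
      where
      α-step : ∀ t → t ∈ Δ → y ∈ along (q , f) t → ∃[ α ] GlobalStep (q , f) α y
      α-step (p , α , p′) t∈ y∈ with p Fin.≟ q
      ... | yes refl with g , g∈ , refl ← ∈-map⁻ _ y∈ =
        α , t∈ , λ c → C.successors-sound c (on c α)
          (choices-sound (λ c → C.successors c (f c) (on c α)) g∈ c)

    succs-complete : ∀ {x α y} → GlobalStep x α y → ∃[ y′ ] y′ ∈ succs x × y ~ y′
    succs-complete {q , f} {α} {q′ , f′} (t∈ , e)
      with g , g∈ , f′≗g ← choices-complete (λ c → C.successors c (f c) (on c α)) f′
                             (λ c → C.successors-complete c (e c)) =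
      (q′ , g) , ∈-concatMap⁺ (along (q , f)) (lose t∈ here-along) , refl , f′≗g
      where
      here-along : (q′ , g) ∈ along (q , f) (q , α , q′)
      here-along with q Fin.≟ q
      ... | yes refl = ∈-map⁺ _ g∈
      ... | no q≢q = contradiction refl q≢q

    start-global : GlobalState
    start-global = q₀ , C.start-state

    GlobalRun : GlobalState → List Act → GlobalState → Set
    GlobalRun (q , f) σ (q′ , f′) = ControlRun q σ q′ × ∀ c → C.LocalRun c (f c) (map (on c) σ) (f′ c)

    _⟶*_ : GlobalState → GlobalState → Set
    _⟶*_ = Star (λ x y → y ∈ succs x)

    trace : ∀ {x y} → x ⟶* y → ∃[ σ ] GlobalRun x σ y
    trace ε = [] , [] , λ c → []
    trace (y∈ ◅ ys) with succs-sound y∈ | trace ys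
    ... | α , t , e | σ , ts , r = α ∷ σ , t ∷ ts , λ c → e c ∷ r c

    L-live : ∀ c → Liveness.Live (proj₁ (L-regular c)) (DFA.start (proj₁ (L-regular c)))
    L-live c = proj₁ (L-inhabited c) , proj₁ (proj₂ (L-regular c)) (proj₂ (L-inhabited c))

    -- Together with `annotate`, this identifies `ℛ` with the contents of the reachable annotated
    -- states, up to pointwise equality.
    realise : ∀ {q f σ} → GlobalRun start-global σ (q , f) →
              ∃[ w ] ℛ (q , w) × ∀ c → w c ≡ C.contents c (f c)
    realise {q} {f} {σ} (ts , r) with assemble _ (λ c → C.contents c (f c)) ts (λ c → C.erase c (r c))
    ... | w , run , w≡ = w , (σ , channelwise⇒Pref L σ pref , run) , w≡
      where
      pref : ∀ c → Pref (L c) (proj! c σ)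
      pref c with v , acc ← C.run-sound c (L-live c) (r c) = v , proj₂ (proj₂ (L-regular c))
        (subst (λ u → Accepted (proj₁ (L-regular c)) (u ++ v)) (sent-on c σ) acc)

    annotate : ∀ {q w} → ((σ , _) : ℛ (q , w)) →
               ∃[ f ] GlobalRun start-global σ (q , f) × ∀ c → C.contents c (f c) ≡ w c
    annotate {q} {w} (σ , pref , run) =
      (λ c → proj₁ (local c)) ,
      (Run⇒control run , λ c → proj₁ (proj₂ (local c))) ,
      λ c → proj₂ (proj₂ (local c))
      where
      local : ∀ c → ∃[ t ] C.LocalRun c (C.start-state c) (map (on c) σ) t × C.contents c t ≡ w c
      local c with v , acc ← Pref⇒channelwise L σ pref c = C.run-complete c (Run⇒queue run c)
        (λ a → let ws , ws≢ , L⊆ = L-bounded c in spell ws≢ (L⊆ (proj₂ (proj₂ (L-regular c)) a)))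
        (v , subst (λ u → Accepted (proj₁ (L-regular c)) (u ++ v)) (sym (sent-on c σ))
               (proj₁ (proj₂ (L-regular c)) acc))

    -- The sum of the lengths in a finite cover bounds every length on `c`.
    unbounded⇒infinite : ∀ c → (∀ n → ∃[ γ ] ℛ γ × n ≤ length (proj₂ γ c)) → Infinite ℛ
    unbounded⇒infinite c unbounded (γs , covers) with unbounded (suc (sum (map size γs)))
      where
      size : Config → ℕ
      size γ = length (proj₂ γ c)
    ... | γ , reach , large = ℕ.≤⇒≯ (bounded γs (covers γ reach)) large
      where
      bounded : ∀ γs → Any (γ ≈_) γs → length (proj₂ γ c) ≤ sum (map (λ γ → length (proj₂ γ c)) γs)
      bounded (γ′ ∷ γs) (here (_ , w≡)) = ℕ.m≤n⇒m≤n+o _ (ℕ.≤-reflexive (cong length (w≡ c)))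
      bounded (γ′ ∷ γs) (there p)       = ℕ.m≤n⇒m≤o+n (length (proj₂ γ′ c)) (bounded γs p)

    module Iteration {q : Q} {f f′ : ∀ c → C.State c} {σ₀ σ : List Act}
      (r₀ : GlobalRun start-global σ₀ (q , f)) (ts : ControlRun q σ q)
      (rep : ∀ c → C.Repeatable c (f c) (map (on c) σ) (f′ c))
      (c₀ : Ch) (grows : C.size c₀ (f c₀) < C.size c₀ (f′ c₀)) where

      module R (c : Ch) = C.Repeatable c (rep c)

      iterate : ∀ n → ∃[ τ ] ∃[ v ] GlobalRun start-global τ (q , v) ×
                (∀ c → R.Inv c (v c)) × n ≤ C.size c₀ (v c₀)
      iterate zero    = σ₀ , f , r₀ , (λ c → R.base c) , z≤n
      iterate (suc n) with iterate n
      ... | τ , v , (ts′ , r) , inv , n≤ =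
        τ ++ σ , (λ c → proj₁ (next c)) ,
        (ts′ ++ʳ ts , λ c → subst (λ l → C.LocalRun c _ l _) (sym (map-++ (on c) τ σ))
                              (r c ++ʳ proj₁ (proj₂ (next c)))) ,
        (λ c → proj₁ (proj₂ (proj₂ (next c)))) ,
        -- The size equation of `step` and the growth of the original run on `c₀` make each
        -- repetition add at least one letter there.
        ℕ.≤-<-trans n≤ (ℕ.+-cancelʳ-< (C.size c₀ (f c₀)) _ _
          (subst (C.size c₀ (v c₀) + C.size c₀ (f c₀) <_) (sym (proj₂ (proj₂ (proj₂ (next c₀)))))
            (ℕ.+-monoʳ-< (C.size c₀ (v c₀)) grows)))
        where
        next = λ c → R.step c (inv c)

      infinite : Infinite ℛ
      infinite = unbounded⇒infinite c₀ λ n → unbounded n (iterate n)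
        where
        unbounded : ∀ n → ∃[ τ ] ∃[ v ] GlobalRun start-global τ (q , v) ×
                    (∀ c → R.Inv c (v c)) × n ≤ C.size c₀ (v c₀) → ∃[ γ ] ℛ γ × n ≤ length (proj₂ γ c₀)
        unbounded n (τ , v , r , _ , n≤) with w , reach , w≡ ← realise r =
          (q , w) , reach ,
          subst (n ≤_) (sym (trans (cong length (w≡ c₀)) (length-map _ (C.queue (v c₀))))) n≤

    -- One control loop is repeatable on all channels at once. Either some channel grows and the
    -- loop is iterated, or all sizes agree and `same` identifies the two states.
    pump : ∀ {x y} → start-global ⟶* x → x ⟶* y → x ⊑ y → y ~ x ⊎ Infinite ℛ
    pump {q , f} {q′ , f′} x* y* (refl , f≼f′) with trace x* | trace y*
    ... | σ₀ , r₀ | σ , ts , r = decide (Fin.any? λ c → C.size c (f c) ℕ.<? C.size c (f′ c))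
      where
      rep : ∀ c → C.Repeatable c (f c) (map (on c) σ) (f′ c)
      rep c = C.repeatable c (C.run-coherent c (proj₂ r₀ c)) (r c) (f≼f′ c)
      decide : Dec (∃[ c ] C.size c (f c) < C.size c (f′ c)) → (q , f′) ~ (q , f) ⊎ Infinite ℛ
      decide (yes (c₀ , grows)) = inj₂ (Iteration.infinite r₀ ts rep c₀ grows)
      decide (no none) = inj₁ (refl , λ c → sym (C.Repeatable.same (rep c)
        (ℕ.≤-antisym (C._≼_.size≤ (f≼f′ c)) (ℕ.≮⇒≥ λ grows → none (c , grows)))))

    open Exploration succs {_~_ = _~_} {R = _⊑_} _⊑?_ (refl , λ _ → refl) (Infinite ℛ) start-global pump
      using (pump-or-closed)

    -- Every annotated run stays within `I` up to `_~_`, and by `annotate` every configuration of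
    -- `ℛ` comes from such a run.
    closed⇒finite : ∀ I → start-global ∈ I → (∀ {x y} → x ∈ I → y ∈ succs x → Any (y ~_) I) → Finite ℛ
    closed⇒finite I start∈ closed = map config I , λ γ reach → cover reach (annotate reach)
      where
      config : GlobalState → Config
      config (q , f) = q , λ c → C.contents c (f c)

      follow : ∀ {σ q f q′ f′} → GlobalRun (q , f) σ (q′ , f′) → Any ((q , f) ~_) I → Any ((q′ , f′) ~_) I
      follow ([] , r) p = Any.map (λ (q≡ , f≡) → q≡ , λ c → trans (sym (Runs-[] (r c))) (f≡ c)) p
      follow {σ = α ∷ σ} {f = f} {f′ = f′} (t ∷ ts , r) p with find p
      ... | (q , g) , x∈ , refl , f≡g =
        follow {f = m} {f′ = f′} (ts , λ c → proj₂ (proj₂ (uncons (r c)))) stepped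
        where
        m : ∀ c → C.State c
        m c = proj₁ (uncons (r c))
        stepped : Any ((_ , m) ~_) I
        stepped with succs-complete {q , g} {α} {_ , m}
          -- Closure is known only for members of `I`, so the step is transported from `f` to its
          -- representative `g`.
          (t , λ c → subst (λ s → C.LocalStep c s (on c α) (m c)) (f≡g c) (proj₁ (proj₂ (uncons (r c)))))
        ... | (_ , g′) , y∈ , refl , m≡g′ =
          Any.map (λ (q≡ , g′≡) → q≡ , λ c → trans (m≡g′ c) (g′≡ c)) (closed x∈ y∈)

      cover : ∀ {q w} (reach : ℛ (q , w)) →
              ∃[ f ] GlobalRun start-global (proj₁ reach) (q , f) × (∀ c → C.contents c (f c) ≡ w c) →
              Any ((q , w) ≈_) (map config I)
      cover reach (f , r , f≡w) = Any.map⁺ (Any.map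
        (λ (q≡ , f≡) → q≡ , λ c → trans (sym (f≡w c)) (cong (C.contents c) (f≡ c)))
        (follow r (Any.map (λ { refl → refl , λ _ → refl }) start∈)))

    decision : Dec (Infinite ℛ)
    decision = [ yes , (λ (I , start∈ , _ , closed) → no λ inf → inf (closed⇒finite I start∈ closed)) ]′
               (pump-or-closed AF-⊑)

theorem5p6 : (M : FIFOMachine) → let open FIFOMachine M in
    (L : (c : Ch) → Language (Msg c)) →
    (∀ c → Satisfiable (L c)) →
    (∀ c → Regular (L c)) →
    (∀ c → Bounded (L c)) →
    Dec (Infinite (Reach (Pref (L ₍!₎))))
theorem5p6 M = Machine.Decision.decision M
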